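{- Let $h_{12}:\{\texttt{0},\texttt{1},\texttt{2},\texttt{3},\texttt{4}\}^*\to\{\texttt{0},\texttt{1}\}^*$ be the morphism $h_{12}(\texttt{0})=\texttt{0011}$, $h_{12}(\texttt{1})=\texttt{01}$, $h_{12}(\texttt{2})=\texttt{001}$, $h_{12}(\texttt{3})=\texttt{011}$, $h_{12}(\texttt{4})=\varepsilon$. Every bi-infinite binary word whose only overlap factor is $\texttt{01010}$ and which contains at most 12 distinct squares as factors has the same set of finite factors as $h_{12}(b_5)$.
   Context: $\varepsilon$ is the empty word. $b_5$ is the fixed point starting with $\texttt{0}$ of the morphism $\texttt{0}\mapsto\texttt{01}$, $\texttt{1}\mapsto\texttt{23}$, $\texttt{2}\mapsto\texttt{4}$, $\texttt{3}\mapsto\texttt{21}$, $\texttt{4}\mapsto\texttt{0}$. A square is a nonempty word $uu$. An overlap is a word $u^nv$ with $u$ nonempty, $v$ a prefix of $u$, and $|u^nv|/|u|>2$. -}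

module Defs where

open import Data.Bool using (Bool; true; false)
open import Data.Nat using (ℕ; zero; suc; _+_; _*_; _<_; _≤_)
open import Data.Integer using (ℤ; +_) renaming (_+_ to _+ℤ_)
open import Data.Fin using (Fin)
open import Data.List using (List; []; _∷_; _++_; length; concat; concatMap; replicate)
open import Data.List.Relation.Unary.All using (All)
open import Data.List.Relation.Unary.Unique.Propositional using (Unique)
open import Data.Product using (Σ; ∃; _×_; _,_)
open import Relation.Binary.PropositionalEquality using (_≡_; _≢_)

𝟎 𝟏 : Bool
𝟎 = false
𝟏 = true

Σ₅ : Set
Σ₅ = Fin 5

σ : Σ₅ → List Σ₅
σ Fin.zero = Fin.zero ∷ Fin.suc Fin.zero ∷ []
σ (Fin.suc Fin.zero) = Fin.suc (Fin.suc Fin.zero) ∷ Fin.suc (Fin.suc (Fin.suc Fin.zero)) ∷ []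
σ (Fin.suc (Fin.suc Fin.zero)) = Fin.suc (Fin.suc (Fin.suc (Fin.suc Fin.zero))) ∷ []
σ (Fin.suc (Fin.suc (Fin.suc Fin.zero))) = Fin.suc (Fin.suc Fin.zero) ∷ Fin.suc Fin.zero ∷ []
σ (Fin.suc (Fin.suc (Fin.suc (Fin.suc Fin.zero)))) = Fin.zero ∷ []

-- σ^n(0); these are prefixes of b₅ of unbounded length, b₅ = lim σ^n(0)
b₅-prefix : ℕ → List Σ₅
b₅-prefix zero = Fin.zero ∷ []
b₅-prefix (suc n) = concatMap σ (b₅-prefix n)

h₁₂-letter : Σ₅ → List Bool
h₁₂-letter Fin.zero = 𝟎 ∷ 𝟎 ∷ 𝟏 ∷ 𝟏 ∷ []
h₁₂-letter (Fin.suc Fin.zero) = 𝟎 ∷ 𝟏 ∷ []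
h₁₂-letter (Fin.suc (Fin.suc Fin.zero)) = 𝟎 ∷ 𝟎 ∷ 𝟏 ∷ []
h₁₂-letter (Fin.suc (Fin.suc (Fin.suc Fin.zero))) = 𝟎 ∷ 𝟏 ∷ 𝟏 ∷ []
h₁₂-letter (Fin.suc (Fin.suc (Fin.suc (Fin.suc Fin.zero)))) = []

h₁₂ : List Σ₅ → List Bool
h₁₂ = concatMap h₁₂-letter

Word : Set
Word = List Bool

_IsFactorOf_ : {A : Set} → List A → List A → Set
x IsFactorOf y = ∃ λ u → ∃ λ v → u ++ x ++ v ≡ y

_IsPrefixOf_ : {A : Set} → List A → List A → Set
v IsPrefixOf u = ∃ λ t → v ++ t ≡ u

Square : Word → Set
Square x = ∃ λ u → u ≢ [] × x ≡ u ++ u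

Overlap : Word → Set
Overlap x = ∃ λ u → ∃ λ n → ∃ λ v →
  u ≢ [] × v IsPrefixOf u × x ≡ concat (replicate n u) ++ v × 2 * length u < length x

BiWord : Set
BiWord = ℤ → Bool

window : BiWord → ℤ → ℕ → Word
window w i zero = []
window w i (suc n) = w i ∷ window w (i +ℤ + 1) n

FactorBi : BiWord → Word → Set
FactorBi w x = ∃ λ i → window w i (length x) ≡ x

Factorh₁₂b₅ : Word → Set
Factorh₁₂b₅ x = ∃ λ n → x IsFactorOf h₁₂ (b₅-prefix n)

w01010 : Word
w01010 = 𝟎 ∷ 𝟏 ∷ 𝟎 ∷ 𝟏 ∷ 𝟎 ∷ []

OnlyOverlap01010 : BiWord → Set
OnlyOverlap01010 w = FactorBi w w01010 × (∀ x → Overlap x → FactorBi w x → x ≡ w01010)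

AtMostSquares : ℕ → BiWord → Set
AtMostSquares k w = ∀ (xs : List Word) → Unique xs → All Square xs → All (FactorBi w) xs → length xs ≤ k

{-# OPTIONS --safe #-}

-- Extending an occurrence of 01010 to the left, an exhaustive search shows that either a second
-- overlap or a thirteenth square appears, or all twelve squares of h₁₂(b₅) have been met; so these
-- are exactly the squares of w.  Since w has no cubes of letters, it is a product of the blocks
-- 0011, 01, 001, 011, and restoring the erased letter 4 writes every long factor, up to a bounded
-- margin, as h₁₂(y).  A second finite check shows that y is square-free with all factors of length
-- 4 occurring in b₅.  This class of words is stable under desubstitution: such a y is σ(z), up to a
-- bounded margin, with z in the class (squares of z map to squares of y, and the factors of length 4
-- are controlled by a third finite check).  So every factor of w lies in h₁₂(σⁿ(z)) for each n.
-- For n large it meets the images of at most two consecutive letters, hence is a factor of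
-- h₁₂(b₅); and as σ³(c) contains 0 for every letter c, all h₁₂(σⁿ(0)) occur in w.

module Submission where

open import Defs
open import Data.Bool using (Bool; T; true; false; _∧_; _∨_; not; if_then_else_)
open import Data.Bool.Properties using (T?) renaming (_≟_ to _≟ᴮ_)
open import Data.Empty using (⊥; ⊥-elim)
open import Data.Fin.Patterns using (0F; 1F; 2F; 3F; 4F)
import Data.Fin.Properties as Fin
open import Data.Integer using (-[1+_]) renaming (+_ to pos; _+_ to _+ℤ_)
import Data.Integer.Properties as ℤ
open import Data.List using (List; []; _∷_; _++_; take; drop; length; concatMap; tails; upTo; filter; replicate; allFin; cartesianProductWith)
open import Data.List.Membership.Propositional using (_∈_)
open import Data.List.Membership.Propositional.Properties using (∈-filter⁺; ∈-cartesianProductWith⁺; ∈-allFin)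
open import Data.List.Properties using (≡-dec; ∷-injectiveˡ; ∷-injectiveʳ; take++drop≡id; take-take; drop-drop; length-take; length-drop; ++-assoc; ++-identityʳ; length-++; concatMap-++)
open import Data.List.Relation.Unary.All as All using (All; []; _∷_)
open import Data.List.Relation.Unary.All.Properties using (¬Any⇒All¬)
open import Data.List.Relation.Unary.AllPairs using ([]; _∷_; allPairs?)
open import Data.List.Relation.Unary.Any as Any using (Any; here)
open import Data.List.Relation.Unary.Linked as Linked using (Linked; []; [-]; _∷_)
open import Data.List.Relation.Unary.Unique.Propositional using (Unique)
open import Data.Maybe using (Maybe; just; nothing; is-just; maybe′; _>>=_)
open import Data.Nat using (ℕ; zero; suc; _+_; _*_; _∸_; _⊓_; _<_; _≤_; _<?_; _≤?_; s≤s; z≤n; ⌊_/2⌋; NonZero)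
open import Data.Nat.Properties
open import Data.Product using (∃; _×_; _,_; proj₁; proj₂)
open import Data.Sum using (_⊎_; inj₁; inj₂; [_,_]′)
open import Data.Unit using (⊤; tt)
open import Function.Bundles using (_⇔_; mk⇔)
open import Relation.Binary.Definitions using (DecidableEquality)
open import Relation.Binary.PropositionalEquality
open import Relation.Nullary using (¬_; Dec; yes; no; does)
open import Relation.Nullary.Decidable using (map′; from-yes; ¬?; _×-dec_; _→-dec_; False; toWitnessFalse)
open import Relation.Unary using (Decidable)

-- Factors of a bi-infinite word

prefix? : {A : Set} → DecidableEquality A → (xs ys : List A) → Dec (xs IsPrefixOf ys)
prefix? _≟_ [] ys = yes (ys , refl)
prefix? _≟_ (x ∷ xs) [] = no λ ()
prefix? _≟_ (x ∷ xs) (y ∷ ys) =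
  map′ (λ { (refl , t , refl) → t , refl }) (λ { (t , refl) → refl , t , refl })
    (x ≟ y ×-dec prefix? _≟_ xs ys)

_≟ᵂ_ : DecidableEquality Word
_≟ᵂ_ = ≡-dec _≟ᴮ_

open import Data.List.Membership.DecPropositional _≟ᵂ_ using (_∈?_)

module _ {w : BiWord} where

  factor-++ˡ : ∀ u {v} → FactorBi w (u ++ v) → FactorBi w u
  factor-++ˡ u (i , eq) = i , go u i eq
    where
    go : ∀ u {v} i → window w i (length (u ++ v)) ≡ u ++ v → window w i (length u) ≡ u
    go [] i eq = refl
    go (c ∷ u) i eq = cong₂ _∷_ (∷-injectiveˡ eq) (go u (i +ℤ pos 1) (∷-injectiveʳ eq))

  factor-++ʳ : ∀ u {v} → FactorBi w (u ++ v) → FactorBi w v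
  factor-++ʳ [] f = f
  factor-++ʳ (c ∷ u) (i , eq) = factor-++ʳ u (i +ℤ pos 1 , ∷-injectiveʳ eq)

  factor-infix : ∀ {x y} → x IsFactorOf y → FactorBi w y → FactorBi w x
  factor-infix {x} (u , v , refl) f = factor-++ˡ x (factor-++ʳ u f)

  extendˡ : ∀ {x} → FactorBi w x → ∃ λ c → FactorBi w (c ∷ x)
  extendˡ {x} (i , eq) = w (i +ℤ -[1+ 0 ]) , i +ℤ -[1+ 0 ] ,
    cong (w (i +ℤ -[1+ 0 ]) ∷_) (trans (cong (λ j → window w j (length x)) shift) eq)
    where
    shift : (i +ℤ -[1+ 0 ]) +ℤ pos 1 ≡ i
    shift = trans (ℤ.+-assoc i -[1+ 0 ] (pos 1)) (ℤ.+-identityʳ i)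

  extendʳ : ∀ {x} → FactorBi w x → ∃ λ c → FactorBi w (x ++ c ∷ [])
  extendʳ {x} (i , eq) = let c , eq′ = go x i eq in c , i , eq′
    where
    go : ∀ x i → window w i (length x) ≡ x →
         ∃ λ c → window w i (length (x ++ c ∷ [])) ≡ x ++ c ∷ []
    go [] i eq = w i , refl
    go (b ∷ x) i eq =
      let c , eq′ = go x (i +ℤ pos 1) (∷-injectiveʳ eq) in c , cong₂ _∷_ (∷-injectiveˡ eq) eq′

-- The left-extension search and its soundness

-- The result `nothing` signals a contradiction: here a thirteenth square, in `checkPeriod` also a
-- forbidden overlap.
insert : Word → List Word → Maybe (List Word)
insert x found =
  if does (x ∈? found) then just found
  else if does (length found <? 12) then just (x ∷ found)
  else nothing

-- A square followed by its own first letter is an overlap. The root `01` is exempt, since its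
-- overlap is the permitted `01010`; then only the square is recorded.
checkPeriod : Bool → Word → Word → List Word → Maybe (List Word)
checkPeriod c u v found =
  if does (prefix? _≟ᴮ_ (c ∷ u) v)
  then (if does (prefix? _≟ᴮ_ (c ∷ u ++ c ∷ []) v) ∧ not (does ((c ∷ u) ≟ᵂ (𝟎 ∷ 𝟏 ∷ [])))
        then nothing
        else insert (c ∷ u ++ c ∷ u) found)
  else just found

-- With ys = drop p xs, the gaps g₁, g₂, … make scan examine the prefixes of c ∷ xs with periods
-- 1 + p + g₁, 1 + p + g₁ + g₂, …
scan : List ℕ → ℕ → Bool → Word → Word → List Word → Maybe (List Word)
scan [] p c xs ys found = just found
scan (g ∷ gs) p c xs ys found =
  checkPeriod c (take (p + g) xs) (drop g ys) found >>= scan gs (p + g) c xs (drop g ys)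

squares : List Word
squares =
  (𝟏 ∷ 𝟎 ∷ 𝟎 ∷ 𝟏 ∷ 𝟎 ∷ 𝟏 ∷ 𝟏 ∷ 𝟎 ∷ 𝟎 ∷ 𝟏 ∷ 𝟏 ∷ 𝟎 ∷ 𝟏 ∷ 𝟎 ∷ 𝟎 ∷ 𝟏 ∷
    𝟏 ∷ 𝟎 ∷ 𝟎 ∷ 𝟏 ∷ 𝟎 ∷ 𝟏 ∷ 𝟏 ∷ 𝟎 ∷ 𝟎 ∷ 𝟏 ∷ 𝟏 ∷ 𝟎 ∷ 𝟏 ∷ 𝟎 ∷ 𝟎 ∷ 𝟏 ∷ [])
  ∷ (𝟎 ∷ 𝟏 ∷ 𝟏 ∷ 𝟎 ∷ 𝟎 ∷ 𝟏 ∷ 𝟎 ∷ 𝟏 ∷ 𝟏 ∷ 𝟎 ∷ 𝟎 ∷ 𝟏 ∷ [])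
  ∷ (𝟏 ∷ 𝟎 ∷ 𝟎 ∷ 𝟏 ∷ 𝟏 ∷ 𝟎 ∷ 𝟏 ∷ 𝟎 ∷ 𝟎 ∷ 𝟏 ∷ 𝟏 ∷ 𝟎 ∷ [])
  ∷ (𝟏 ∷ 𝟎 ∷ 𝟎 ∷ 𝟏 ∷ 𝟎 ∷ 𝟏 ∷ 𝟏 ∷ 𝟎 ∷ 𝟎 ∷ 𝟏 ∷ 𝟎 ∷ 𝟏 ∷ [])
  ∷ (𝟏 ∷ 𝟎 ∷ 𝟏 ∷ 𝟎 ∷ 𝟎 ∷ 𝟏 ∷ 𝟏 ∷ 𝟎 ∷ 𝟏 ∷ 𝟎 ∷ 𝟎 ∷ 𝟏 ∷ [])
  ∷ (𝟏 ∷ 𝟎 ∷ 𝟎 ∷ 𝟏 ∷ 𝟏 ∷ 𝟎 ∷ 𝟎 ∷ 𝟏 ∷ [])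
  ∷ (𝟎 ∷ 𝟏 ∷ 𝟏 ∷ 𝟎 ∷ 𝟎 ∷ 𝟏 ∷ 𝟏 ∷ 𝟎 ∷ [])
  ∷ (𝟎 ∷ 𝟏 ∷ 𝟎 ∷ 𝟎 ∷ 𝟏 ∷ 𝟎 ∷ [])
  ∷ (𝟎 ∷ 𝟏 ∷ 𝟎 ∷ 𝟏 ∷ [])
  ∷ (𝟏 ∷ 𝟎 ∷ 𝟏 ∷ 𝟎 ∷ [])
  ∷ (𝟎 ∷ 𝟎 ∷ [])
  ∷ (𝟏 ∷ 𝟏 ∷ []) ∷ []

-- The periods 1–6, 8, 9, 12, 16, 17, 23, 24, 27, 32, 37, 38, 39, 41, 42, 50, 63, 67, 71, 118, found
-- by experiment: they are the only ones at which the search meets a square.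
gaps : List ℕ
gaps = 0 ∷ 1 ∷ 1 ∷ 1 ∷ 1 ∷ 1 ∷ 2 ∷ 1 ∷ 3 ∷ 4 ∷ 1 ∷ 6 ∷ 1 ∷ 3 ∷ 5 ∷ 5 ∷ 1 ∷ 1 ∷ 2 ∷ 1 ∷ 8 ∷ 13 ∷ 4 ∷ 4 ∷ 47 ∷ []

-- Each step looks only at repetitions starting at the newest letter. Overlooking a repetition can
-- only keep a branch open, so soundness holds for every list of gaps.
search : List ℕ → List Word → ℕ → Word → List Word → Bool
search gs target zero xs found = false
search gs target (suc n) xs found =
  does (All.all? (_∈? found) target) ∨ (extend 𝟎 ∧ extend 𝟏)
  where
  extend : Bool → Bool
  -- A contradictory extension closes its branch, hence the default `true`.
  extend c = maybe′ (search gs target n (c ∷ xs)) true (scan gs 0 c xs xs found)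

abstract
  -- The number 400 is fuel bounding the depth of the search; running out of it would yield `false`.
  search-succeeds : search gaps squares 400 w01010 [] ≡ true
  search-succeeds = refl

squares-unique : Unique squares
squares-unique = from-yes (allPairs? (λ x y → ¬? (x ≟ᵂ y)) squares)

squares-square : All Square squares
squares-square = All.tabulate λ {x} x∈ → half x , All.lookup halves x∈
  where
  half : Word → Word
  half x = take ⌊ length x /2⌋ x
  halves : All (λ x → half x ≢ [] × x ≡ half x ++ half x) squares
  halves = from-yes (All.all? (λ x → ¬? (half x ≟ᵂ []) ×-dec (x ≟ᵂ (half x ++ half x))) squares)

-- Comparing lengths, `2n + 1 = 5` forces a root of two letters.
overlap-root : ∀ c u → (c ∷ u) ++ (c ∷ u) ++ c ∷ [] ≡ w01010 → c ∷ u ≡ 𝟎 ∷ 𝟏 ∷ []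
overlap-root c [] ()
overlap-root c (d ∷ []) refl = refl
overlap-root c (d ∷ e ∷ []) ()
overlap-root c (d ∷ e ∷ f ∷ []) ()
overlap-root c (d ∷ e ∷ f ∷ g ∷ []) ()
overlap-root c (d ∷ e ∷ f ∷ g ∷ h ∷ u) ()

isOverlap : ∀ c u → Overlap ((c ∷ u) ++ (c ∷ u) ++ c ∷ [])
isOverlap c u = c ∷ u , 2 , c ∷ [] , (λ ()) , (u , refl) ,
  trans (cong ((c ∷ u) ++_) (cong (_++ c ∷ []) (sym (++-identityʳ (c ∷ u)))))
        (sym (++-assoc (c ∷ u) ((c ∷ u) ++ []) (c ∷ []))) ,
  ≤-reflexive (sym len)
  where
  open ≡-Reasoning
  n = length (c ∷ u)
  len : length ((c ∷ u) ++ (c ∷ u) ++ c ∷ []) ≡ suc (2 * n)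
  len = begin
    length ((c ∷ u) ++ (c ∷ u) ++ c ∷ [])    ≡⟨ length-++ (c ∷ u) ⟩
    n + length ((c ∷ u) ++ c ∷ [])           ≡⟨ cong (n +_) (length-++ (c ∷ u)) ⟩
    n + (n + 1)                              ≡⟨ cong (n +_) (+-comm n 1) ⟩
    n + suc n                                ≡⟨ +-suc n n ⟩
    suc (n + n)                              ≡⟨ cong (λ m → suc (n + m)) (sym (+-identityʳ n)) ⟩
    suc (2 * n)                              ∎

module _ {w : BiWord} (only : OnlyOverlap01010 w) (few : AtMostSquares 12 w) where

  Collected : List Word → Set
  Collected found = Unique found × All Square found × All (FactorBi w) found

  Sound : Maybe (List Word) → Set
  Sound nothing = ⊥
  Sound (just found) = Collected found

  >>=-sound : ∀ m {k} → Sound m → (∀ {f} → Collected f → Sound (k f)) → Sound (m >>= k)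
  >>=-sound (just f) s k = k s

  if-sound : ∀ {P : Set} (P? : Dec P) {a b} → (P → Sound a) → (¬ P → Sound b) →
             Sound (if does P? then a else b)
  if-sound (yes p) a b = a p
  if-sound (no ¬p) a b = b ¬p

  insert-sound : ∀ {x found} → Square x → FactorBi w x → Collected found → Sound (insert x found)
  insert-sound {x} {found} sq f col@(u , s , a) =
    if-sound (x ∈? found) (λ _ → col) (λ x∉ → if-sound (length found <? 12)
      (λ _ → ¬Any⇒All¬ found x∉ ∷ u , sq ∷ s , f ∷ a)
      (λ full → full (few (x ∷ found) (¬Any⇒All¬ found x∉ ∷ u) (sq ∷ s) (f ∷ a))))

  checkPeriod-sound : ∀ c u v {found} → FactorBi w ((c ∷ u) ++ v) → Collected found →
                      Sound (checkPeriod c u v found)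
  checkPeriod-sound c u v {found} f col =
    if-sound (prefix? _≟ᴮ_ (c ∷ u) v)
      (λ { (t , refl) → if-sound
        (prefix? _≟ᴮ_ (c ∷ u ++ c ∷ []) v ×-dec ¬? ((c ∷ u) ≟ᵂ (𝟎 ∷ 𝟏 ∷ [])))
        (λ { ((s , eq) , ≢01) → ≢01 (overlap-root c u (proj₂ only _ (isOverlap c u)
          (factor-++ˡ ((c ∷ u) ++ (c ∷ u) ++ c ∷ []) {s}
            (subst (FactorBi w) (trans (cong ((c ∷ u) ++_) (sym eq))
              (sym (++-assoc (c ∷ u) (c ∷ u ++ c ∷ []) s))) f)))) })
        (λ _ → insert-sound (c ∷ u , (λ ()) , refl) (factor-++ˡ ((c ∷ u) ++ (c ∷ u)) {t}
          (subst (FactorBi w) (sym (++-assoc (c ∷ u) (c ∷ u) t)) f)) col) })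
      (λ _ → col)

  scan-sound : ∀ gs p c xs {found} → FactorBi w (c ∷ xs) → Collected found →
               Sound (scan gs p c xs (drop p xs) found)
  scan-sound [] p c xs f col = col
  -- The rewriting restores the invariant that the remaining word is `xs` with the whole current
  -- offset dropped.
  scan-sound (g ∷ gs) p c xs {found} f col rewrite drop-drop p g xs =
    >>=-sound (checkPeriod c (take (p + g) xs) (drop (p + g) xs) found)
      (checkPeriod-sound c (take (p + g) xs) (drop (p + g) xs)
        (subst (λ ys → FactorBi w (c ∷ ys)) (sym (take++drop≡id (p + g) xs)) f) col)
      (scan-sound gs (p + g) c xs f)

  search-sound : ∀ gs target n xs found → FactorBi w xs → Collected found →
                 search gs target n xs found ≡ true → All (FactorBi w) target
  search-sound gs target (suc n) xs found f col eq with All.all? (_∈? found) target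
  ... | yes all∈ = All.map (All.lookup (proj₂ (proj₂ col))) all∈
  -- The letter preceding this occurrence in `w` selects one of the two branches, and both are known
  -- to succeed.
  ... | no _ = let c , f′ = extendˡ f in descend c f′ (∧-split extend eq c)
    where
    extend : Bool → Bool
    extend c = maybe′ (search gs target n (c ∷ xs)) true (scan gs 0 c xs xs found)
    ∧-split : ∀ (g : Bool → Bool) → g 𝟎 ∧ g 𝟏 ≡ true → ∀ c → g c ≡ true
    ∧-split g eq c with g 𝟎 in eq₀
    ∧-split g eq false | true = eq₀
    ∧-split g eq true | true = eq
    descend : ∀ c → FactorBi w (c ∷ xs) → extend c ≡ true → All (FactorBi w) target
    descend c f eq with scan gs 0 c xs xs found | scan-sound gs 0 c xs f col
    ... | just found′ | col′ = search-sound gs target n (c ∷ xs) found′ f col′ eq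

  squares-occur : All (FactorBi w) squares
  squares-occur = search-sound gaps squares 400 w01010 [] (proj₁ only) ([] , [] , []) search-succeeds

  -- The twelve listed squares already use up the allowance.
  squares-exhaustive : ∀ {x} → Square x → FactorBi w x → x ∈ squares
  squares-exhaustive {x} sq f with x ∈? squares
  ... | yes x∈ = x∈
  ... | no x∉ = ⊥-elim (1+n≰n (few (x ∷ squares)
        (¬Any⇒All¬ squares x∉ ∷ squares-unique) (sq ∷ squares-square) (f ∷ squares-occur)))

-- Factors of finite words and length bounds

module _ {A : Set} where

  factor-trans : {x y z : List A} → x IsFactorOf y → y IsFactorOf z → x IsFactorOf z
  factor-trans {x} (u , v , refl) (u′ , v′ , refl) = u′ ++ u , v ++ v′ , (begin
    (u′ ++ u) ++ x ++ v ++ v′    ≡⟨ ++-assoc u′ u _ ⟩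
    u′ ++ u ++ x ++ v ++ v′      ≡⟨ cong (λ t → u′ ++ u ++ t) (++-assoc x v v′) ⟨
    u′ ++ u ++ (x ++ v) ++ v′    ≡⟨ cong (u′ ++_) (++-assoc u (x ++ v) v′) ⟨
    u′ ++ (u ++ x ++ v) ++ v′    ∎)
    where open ≡-Reasoning

  infix-++ : (u : List A) {x : List A} (v : List A) → x IsFactorOf (u ++ x ++ v)
  infix-++ u v = u , v , refl

  prefix-++ : (x : List A) {v : List A} → x IsFactorOf (x ++ v)
  prefix-++ x {v} = infix-++ [] v

  suffix-++ : (u : List A) {x : List A} → x IsFactorOf (u ++ x)
  suffix-++ u {x} = u , [] , cong (u ++_) (++-identityʳ x)

  ++-split : ∀ (a : List A) {s} l {t} → a ++ s ≡ l ++ t → length a ≤ length l →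
             ∃ λ l′ → l ≡ a ++ l′ × s ≡ l′ ++ t
  ++-split [] l eq _ = l , refl , eq
  ++-split (c ∷ a) (d ∷ l) eq (s≤s le) =
    let l′ , e₁ , e₂ = ++-split a l (∷-injectiveʳ eq) le
    in l′ , cong₂ _∷_ (sym (∷-injectiveˡ eq)) e₁ , e₂

  -- With `a` and `b` no longer than `l` and `r`, the middle `m` reaches at least as far as `x` on
  -- both sides. This absorbs the letters lost at the ends by decoding and desubstitution.
  infix-trim : ∀ (l : List A) {x} r a m b → l ++ x ++ r ≡ a ++ m ++ b →
               length a ≤ length l → length b ≤ length r → x IsFactorOf m
  infix-trim l {x} r a m b eq a≤l b≤r with ++-split a l (sym eq) a≤l
  ... | l′ , refl , eq′ with ++-split (l′ ++ x) m (trans (++-assoc l′ x r) (sym eq′)) short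
    where
    open ≤-Reasoning
    short : length (l′ ++ x) ≤ length m
    short = +-cancelʳ-≤ (length r) _ _ (begin
      length (l′ ++ x) + length r    ≡⟨ length-++ (l′ ++ x) ⟨
      length ((l′ ++ x) ++ r)        ≡⟨ cong length (trans (++-assoc l′ x r) (sym eq′)) ⟩
      length (m ++ b)                ≡⟨ length-++ m ⟩
      length m + length b            ≤⟨ +-monoʳ-≤ (length m) b≤r ⟩
      length m + length r            ∎)
  ...   | m′ , refl , _ = l′ , m′ , sym (++-assoc l′ x m′)

  last-split : ∀ (c : A) a → ∃ λ a′ → ∃ λ d → c ∷ a ≡ a′ ++ d ∷ []
  last-split c [] = [] , c , refl
  last-split c (b ∷ a) = let a′ , d , eq = last-split b a in c ∷ a′ , d , cong (c ∷_) eq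

  -- Sets aside the context that `locally-legal` consumes: one letter on the left, `k` on the right.
  middle-split : ∀ k (y : List A) → suc k ≤ length y →
                 ∃ λ c → ∃ λ m → ∃ λ e → y ≡ c ∷ m ++ e × length e ≡ k
  middle-split k (c ∷ y) (s≤s k≤) =
    c , take (length y ∸ k) y , drop (length y ∸ k) y ,
    cong (c ∷_) (sym (take++drop≡id (length y ∸ k) y)) ,
    trans (length-drop (length y ∸ k) y) (m∸[m∸n]≡n k≤)

  All-tails : ∀ {R : List A → Set} y → (∀ {s} → s IsFactorOf y → R s) → All R (tails y)
  All-tails [] r = r ([] , [] , refl) ∷ []
  All-tails (c ∷ y) r = r ([] , [] , cong (c ∷_) (++-identityʳ y)) ∷
    All-tails y (λ f → r (factor-trans f (suffix-++ (c ∷ []))))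

  length-concatMap-≤ : ∀ {B : Set} (f : B → List A) k → (∀ c → length (f c) ≤ k) →
                       ∀ y → length (concatMap f y) ≤ k * length y
  length-concatMap-≤ f k f≤ [] = z≤n
  length-concatMap-≤ f k f≤ (c ∷ y) = begin
    length (f c ++ concatMap f y)            ≡⟨ length-++ (f c) ⟩
    length (f c) + length (concatMap f y)    ≤⟨ +-mono-≤ (f≤ c) (length-concatMap-≤ f k f≤ y) ⟩
    k + k * length y                         ≡⟨ *-suc k (length y) ⟨
    k * suc (length y)                       ∎
    where open ≤-Reasoning

  length-factor : {x y : List A} → x IsFactorOf y → length x ≤ length y
  length-factor {x} (u , v , refl) = begin
    length x                           ≤⟨ m≤m+n _ _ ⟩
    length x + length v                ≡⟨ length-++ x ⟨
    length (x ++ v)                    ≤⟨ m≤n+m _ _ ⟩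
    length u + length (x ++ v)         ≡⟨ length-++ u ⟨
    length (u ++ x ++ v)               ∎
    where open ≤-Reasoning

concatMap-factor : ∀ {A B : Set} (f : A → List B) {x y} → x IsFactorOf y →
                   concatMap f x IsFactorOf concatMap f y
concatMap-factor f {x} (u , v , refl) = concatMap f u , concatMap f v ,
  sym (trans (concatMap-++ f u (x ++ v)) (cong (concatMap f u ++_) (concatMap-++ f x v)))

-- Local structure of b₅

σ* : List Σ₅ → List Σ₅
σ* = concatMap σ

fours : List (List Σ₅)
fours =
  (0F ∷ 1F ∷ 0F ∷ 4F ∷ []) ∷ (0F ∷ 1F ∷ 2F ∷ 3F ∷ []) ∷ (0F ∷ 4F ∷ 2F ∷ 1F ∷ []) ∷
  (0F ∷ 4F ∷ 2F ∷ 3F ∷ []) ∷ (1F ∷ 0F ∷ 1F ∷ 2F ∷ []) ∷ (1F ∷ 0F ∷ 4F ∷ 2F ∷ []) ∷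
  (1F ∷ 2F ∷ 3F ∷ 0F ∷ []) ∷ (1F ∷ 2F ∷ 3F ∷ 4F ∷ []) ∷ (2F ∷ 1F ∷ 0F ∷ 1F ∷ []) ∷
  (2F ∷ 1F ∷ 0F ∷ 4F ∷ []) ∷ (2F ∷ 3F ∷ 0F ∷ 1F ∷ []) ∷ (2F ∷ 3F ∷ 4F ∷ 2F ∷ []) ∷
  (3F ∷ 0F ∷ 1F ∷ 0F ∷ []) ∷ (3F ∷ 0F ∷ 1F ∷ 2F ∷ []) ∷ (3F ∷ 4F ∷ 2F ∷ 1F ∷ []) ∷
  (4F ∷ 2F ∷ 1F ∷ 0F ∷ []) ∷ (4F ∷ 2F ∷ 3F ∷ 0F ∷ []) ∷ []

Legal : List Σ₅ → Set
Legal x = Any (x IsPrefixOf_) fours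

legal? : Decidable Legal
legal? x = Any.any? (prefix? Fin._≟_ x) fours

LocallyLegal : List Σ₅ → Set
LocallyLegal y = ∀ {x} → x IsFactorOf y → length x ≤ 4 → Legal x

SquareFree : List Σ₅ → Set
SquareFree y = ∀ {x} → (x ++ x) IsFactorOf y → x ≡ []

legal-prefix : ∀ x {z} → Legal (x ++ z) → Legal x
legal-prefix x {z} = Any.map λ { (t , refl) → z ++ t , sym (++-assoc x z t) }

-- Filtering at every length prunes the enumeration: a word is extended only if all its nonempty
-- suffixes pass `Q?`.
words : {Q : List Σ₅ → Set} → Decidable Q → ℕ → List (List Σ₅)
words Q? zero = [] ∷ []
words Q? (suc n) = filter Q? (cartesianProductWith _∷_ (allFin 5) (words Q? n))

-- `P` may be undecidable, such as a statement about `w`; it enters only through its decidable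
-- consequence `Q` and its closure under tails.
words-complete : ∀ {P Q : List Σ₅ → Set} (Q? : Decidable Q) → (∀ {y} → P y → Q y) →
                 (∀ {c y} → P (c ∷ y) → P y) → ∀ y → P y → y ∈ words Q? (length y)
words-complete Q? P⇒Q P-tail [] p = here refl
words-complete Q? P⇒Q P-tail (c ∷ y) p = ∈-filter⁺ Q?
  (∈-cartesianProductWith⁺ _∷_ (∈-allFin c) (words-complete Q? P⇒Q P-tail y (P-tail p))) (P⇒Q p)

take-++-≤ : ∀ {A : Set} m (x : List A) {z} → length x ≤ m → take m (x ++ z) ≡ x ++ take (m ∸ length x) z
take-++-≤ m [] _ = refl
take-++-≤ (suc m) (c ∷ x) (s≤s le) = cong (c ∷_) (take-++-≤ m x le)

-- A window consists of one letter of left context, the four letters under test, and right context.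
Checked : {Q : List Σ₅ → Set} → Decidable Q → ℕ → Set
Checked Q? n = All (λ z → Legal (take 4 (drop 1 z))) (words Q? (suc n))

-- An occurrence of `x` in `y` has a letter on its left thanks to `c`, and at least `n` letters from
-- its start onwards thanks to `e`. So it lies in a full window, right after the first letter.
locally-legal : ∀ {P Q : List Σ₅ → Set} (Q? : Decidable Q) → (∀ {y} → P y → Q y) →
                (∀ {x y} → x IsFactorOf y → P y → P x) →
                ∀ n → 4 ≤ n → Checked Q? n →
                ∀ c y e → length e ≡ n → P (c ∷ y ++ e) → LocallyLegal y
locally-legal {P} Q? P⇒Q P-factor n 4≤n checked c y e |e| p {x} (a , b , refl) x≤4
  with last-split c a
... | a′ , d , eq = legal-prefix x (subst Legal cut (All.lookup checked
  (subst (λ m → d ∷ take n r ∈ words Q? m) len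
    (words-complete Q? P⇒Q (P-factor (suffix-++ (_ ∷ []))) (d ∷ take n r) (P-factor inside p)))))
  where
  r = x ++ b ++ e
  inside : (d ∷ take n r) IsFactorOf (c ∷ (a ++ x ++ b) ++ e)
  inside = a′ , drop n r , (begin
    a′ ++ d ∷ take n r ++ drop n r    ≡⟨ cong (λ t → a′ ++ d ∷ t) (take++drop≡id n r) ⟩
    a′ ++ d ∷ r                       ≡⟨ ++-assoc a′ (d ∷ []) r ⟨
    (a′ ++ d ∷ []) ++ r               ≡⟨ cong (_++ r) eq ⟨
    c ∷ a ++ x ++ b ++ e              ≡⟨ cong (λ t → c ∷ a ++ t) (++-assoc x b e) ⟨
    c ∷ a ++ (x ++ b) ++ e            ≡⟨ cong (c ∷_) (++-assoc a (x ++ b) e) ⟨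
    c ∷ (a ++ x ++ b) ++ e            ∎)
    where open ≡-Reasoning
  len : suc (length (take n r)) ≡ suc n
  len = cong suc (trans (length-take n r) (m≤n⇒m⊓n≡m (begin
    n                  ≡⟨ |e| ⟨
    length e           ≤⟨ length-factor (suffix-++ b) ⟩
    length (b ++ e)    ≤⟨ length-factor (suffix-++ x) ⟩
    length r           ∎)))
    where open ≤-Reasoning
  cut : take 4 (take n r) ≡ x ++ take (4 ∸ length x) (b ++ e)
  cut = begin
    take 4 (take n r)                       ≡⟨ take-take 4 n r ⟩
    take (4 ⊓ n) r                          ≡⟨ cong (λ m → take m r) (m≤n⇒m⊓n≡m 4≤n) ⟩
    take 4 r                                ≡⟨ take-++-≤ 4 x x≤4 ⟩
    x ++ take (4 ∸ length x) (b ++ e)       ∎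
    where open ≡-Reasoning

-- Desubstitution

NoSquarePrefix : List Σ₅ → Set
NoSquarePrefix s = All (λ p → ¬ take (suc p) s IsPrefixOf drop (suc p) s) (upTo (length s))

-- A decidable consequence of `Nice (σ* y)`; looking at prefixes of suffixes reaches every factor.
Admissible : List Σ₅ → Set
Admissible y = All (λ s → Legal (take 4 s) × NoSquarePrefix s) (tails (σ* y))

admissible? : Decidable Admissible
admissible? y = All.all? (λ s → legal? (take 4 s) ×-dec
  All.all? (λ p → ¬? (prefix? Fin._≟_ (take (suc p) s) (drop (suc p) s))) (upTo (length s))) (tails (σ* y))

Nice : List Σ₅ → Set
Nice y = SquareFree y × LocallyLegal y

nice-factor : ∀ {x y} → x IsFactorOf y → Nice y → Nice x
nice-factor x⊑y (sf , ll) = (λ f → sf (factor-trans f x⊑y)) , (λ f → ll (factor-trans f x⊑y))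

nice⇒admissible : ∀ {y} → Nice (σ* y) → Admissible y
nice⇒admissible {y} (sf , ll) = All-tails (σ* y) λ {s} s⊑ →
  ll (factor-trans ([] , drop 4 s , take++drop≡id 4 s) s⊑)
     (≤-trans (≤-reflexive (length-take 4 s)) (m⊓n≤m 4 (length s))) ,
  no-square s s⊑
  where
  no-square : ∀ s → s IsFactorOf σ* y → NoSquarePrefix s
  no-square [] _ = []
  no-square (c ∷ s) s⊑ = All.tabulate λ { {p} _ (r , eq) →
    nonempty (sf (factor-trans ([] , r , trans (++-assoc (c ∷ take p s) _ r)
      (trans (cong ((c ∷ take p s) ++_) eq) (take++drop≡id (suc p) (c ∷ s)))) s⊑)) }
    where
    nonempty : ∀ {u : List Σ₅} → c ∷ u ≡ [] → ⊥
    nonempty ()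

abstract
  admissible-legal : Checked admissible? 6
  admissible-legal = from-yes (All.all? (λ z → legal? (take 4 (drop 1 z))) (words admissible? 7))

-- The last letter of an image `01`, `21` or `23` whose first letter is still to be read.
data Pending : List Σ₅ → Set where
  none  : Pending []
  one   : Pending (1F ∷ [])
  three : Pending (3F ∷ [])

-- A `2` at the right end, whose image `21` or `23` is cut off.
data Remnant : List Σ₅ → Set where
  none : Remnant []
  two  : Remnant (2F ∷ [])

-- The parse runs from right to left. A `1` or `3` waits for the letter before it, a `0` with no `1`
-- waiting is the image of `4`, and a `4` is the image of `2`. Adjacencies that fit no image are
-- illegal pairs.
desubstitute : ∀ y → LocallyLegal y → ∃ λ p → ∃ λ z → ∃ λ s →
               y ≡ p ++ σ* z ++ s × Pending p × Remnant s
desubstitute [] ll = [] , [] , [] , refl , none , none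
desubstitute (c ∷ y) ll with desubstitute y (λ f → ll (factor-trans f (suffix-++ (c ∷ []))))
... | p , z , s , refl , pending , remnant = attach c p z pending remnant ll
  where
  absurd-pair : ∀ c d {y} {A : Set} → {illegal : False (legal? (c ∷ d ∷ []))} → LocallyLegal (c ∷ d ∷ y) → A
  absurd-pair c d {illegal = i} ll =
    ⊥-elim (toWitnessFalse i (ll (prefix-++ (c ∷ d ∷ [])) (s≤s (s≤s z≤n))))
  attach : ∀ c p z {s} → Pending p → Remnant s → LocallyLegal (c ∷ p ++ σ* z ++ s) →
           ∃ λ p′ → ∃ λ z′ → ∃ λ s′ → c ∷ p ++ σ* z ++ s ≡ p′ ++ σ* z′ ++ s′ × Pending p′ × Remnant s′
  attach 0F _ z none r _ = [] , 4F ∷ z , _ , refl , none , r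
  attach 1F _ z none r _ = 1F ∷ [] , z , _ , refl , one , r
  attach 2F _ [] none none _ = [] , [] , 2F ∷ [] , refl , none , two
  attach 2F _ [] none two ll = absurd-pair 2F 2F ll
  attach 2F _ (0F ∷ z) none r ll = absurd-pair 2F 0F ll
  attach 2F _ (1F ∷ z) none r ll = absurd-pair 2F 2F ll
  attach 2F _ (2F ∷ z) none r ll = absurd-pair 2F 4F ll
  attach 2F _ (3F ∷ z) none r ll = absurd-pair 2F 2F ll
  attach 2F _ (4F ∷ z) none r ll = absurd-pair 2F 0F ll
  attach 3F _ z none r _ = 3F ∷ [] , z , _ , refl , three , r
  attach 4F _ z none r _ = [] , 2F ∷ z , _ , refl , none , r
  attach 0F _ z one r _ = [] , 0F ∷ z , _ , refl , none , r
  attach 1F _ z one r ll = absurd-pair 1F 1F ll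
  attach 2F _ z one r _ = [] , 3F ∷ z , _ , refl , none , r
  attach 3F _ z one r ll = absurd-pair 3F 1F ll
  attach 4F _ z one r ll = absurd-pair 4F 1F ll
  attach 0F _ z three r ll = absurd-pair 0F 3F ll
  attach 1F _ z three r ll = absurd-pair 1F 3F ll
  attach 2F _ z three r _ = [] , 1F ∷ z , _ , refl , none , r
  attach 3F _ z three r ll = absurd-pair 3F 3F ll
  attach 4F _ z three r ll = absurd-pair 4F 3F ll

pending≤1 : ∀ {p} → Pending p → length p ≤ 1
pending≤1 none = z≤n
pending≤1 one = ≤-refl
pending≤1 three = ≤-refl

remnant≤1 : ∀ {s} → Remnant s → length s ≤ 1
remnant≤1 none = z≤n
remnant≤1 two = ≤-refl

length-σ≤2 : ∀ c → length (σ c) ≤ 2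
length-σ≤2 = from-yes (Fin.all? (λ c → length (σ c) ≤? 2))

length-σ* : ∀ y → length (σ* y) ≤ 2 * length y
length-σ* = length-concatMap-≤ σ 2 length-σ≤2

σ*-nonempty : ∀ x → σ* x ≡ [] → x ≡ []
σ*-nonempty [] _ = refl
σ*-nonempty (0F ∷ x) ()
σ*-nonempty (1F ∷ x) ()
σ*-nonempty (2F ∷ x) ()
σ*-nonempty (3F ∷ x) ()
σ*-nonempty (4F ∷ x) ()

squareFree-σ* : ∀ y → SquareFree (σ* y) → SquareFree y
squareFree-σ* y sf {x} f =
  σ*-nonempty x (sf (subst (_IsFactorOf σ* y) (concatMap-++ σ x x) (concatMap-factor σ f)))

-- The property inherited by windows is `Nice` of the image, because niceness of the preimage is
-- what has to be shown. Windows have seven letters.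
locallyLegal-σ* : ∀ c y e → length e ≡ 6 → Nice (σ* (c ∷ y ++ e)) → LocallyLegal y
locallyLegal-σ* = locally-legal {P = λ y → Nice (σ* y)} admissible? (λ {y} → nice⇒admissible {y})
  (λ f → nice-factor (concatMap-factor σ f)) 6 (m≤m+n 4 2) admissible-legal

-- Since `|y| ≤ 2|z| + 2`, the bound 16 leaves a preimage of at least seven letters, one of which is
-- given up on the left and six on the right. With the pending letter and the remnant, the margins
-- are `1 + 2 = 3` and `2 · 6 + 1 = 13`.
nice-desubstitute : ∀ y → Nice y → 16 ≤ length y → ∃ λ p → ∃ λ z → ∃ λ s →
                    y ≡ p ++ σ* z ++ s × length p ≤ 3 × length s ≤ 13 × Nice z
nice-desubstitute y nice@(sf , ll) long with desubstitute y ll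
... | p , z , s , refl , pending , remnant with middle-split 6 z long-z
  where
  open ≤-Reasoning
  long-z : 7 ≤ length z
  long-z = *-cancelˡ-≤ 2 (+-cancelʳ-≤ 2 _ _ (begin
    16                                           ≤⟨ long ⟩
    length (p ++ σ* z ++ s)                      ≡⟨ trans (length-++ p) (cong (length p +_) (length-++ (σ* z))) ⟩
    length p + (length (σ* z) + length s)        ≤⟨ +-mono-≤ (pending≤1 pending) (+-mono-≤ (length-σ* z) (remnant≤1 remnant)) ⟩
    1 + (2 * length z + 1)                       ≡⟨ +-suc (2 * length z) 1 ⟨
    2 * length z + 2                             ∎))
...   | c , m , e , refl , |e| = p ++ σ c , m , σ* e ++ s , eq , p≤ , s≤ ,
  squareFree-σ* m (proj₁ nice-m) , locallyLegal-σ* c m e |e| nice-z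
  where
  nice-z : Nice (σ* (c ∷ m ++ e))
  nice-z = nice-factor (infix-++ p s) nice
  nice-m : Nice (σ* m)
  nice-m = nice-factor (concatMap-factor σ (infix-++ (c ∷ []) {m} e)) nice-z
  eq : p ++ σ* (c ∷ m ++ e) ++ s ≡ (p ++ σ c) ++ σ* m ++ σ* e ++ s
  eq = begin
    p ++ (σ c ++ σ* (m ++ e)) ++ s       ≡⟨ cong (λ t → p ++ (σ c ++ t) ++ s) (concatMap-++ σ m e) ⟩
    p ++ (σ c ++ σ* m ++ σ* e) ++ s      ≡⟨ cong (p ++_) (++-assoc (σ c) (σ* m ++ σ* e) s) ⟩
    p ++ σ c ++ (σ* m ++ σ* e) ++ s      ≡⟨ cong (λ t → p ++ σ c ++ t) (++-assoc (σ* m) (σ* e) s) ⟩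
    p ++ σ c ++ σ* m ++ σ* e ++ s        ≡⟨ ++-assoc p (σ c) _ ⟨
    (p ++ σ c) ++ σ* m ++ σ* e ++ s      ∎
    where open ≡-Reasoning
  p≤ : length (p ++ σ c) ≤ 3
  p≤ = ≤-trans (≤-reflexive (length-++ p)) (+-mono-≤ (pending≤1 pending) (length-σ≤2 c))
  s≤ : length (σ* e ++ s) ≤ 13
  s≤ = ≤-trans (≤-reflexive (length-++ (σ* e)))
    (+-mono-≤ (≤-trans (length-σ* e) (≤-reflexive (cong (2 *_) |e|))) (remnant≤1 remnant))

-- The images h₁₂ (σⁿ y)

H : ℕ → List Σ₅ → Word
H zero y = h₁₂ y
H (suc n) y = H n (σ* y)

H-++ : ∀ n x y → H n (x ++ y) ≡ H n x ++ H n y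
H-++ zero x y = concatMap-++ h₁₂-letter x y
H-++ (suc n) x y = trans (cong (H n) (concatMap-++ σ x y)) (H-++ n (σ* x) (σ* y))

H-factor : ∀ n {x y} → x IsFactorOf y → H n x IsFactorOf H n y
H-factor zero = concatMap-factor h₁₂-letter
H-factor (suc n) f = H-factor n (concatMap-factor σ f)

H-[] : ∀ n → H n [] ≡ []
H-[] zero = refl
H-[] (suc n) = H-[] n

H-b₅-prefix : ∀ n m → H n (b₅-prefix m) ≡ h₁₂ (b₅-prefix (n + m))
H-b₅-prefix zero m = refl
H-b₅-prefix (suc n) m = trans (H-b₅-prefix n (suc m)) (cong (λ k → h₁₂ (b₅-prefix k)) (+-suc n m))

-- This is `4 · 2ⁿ`: each `σ c` has at most two letters, each `h₁₂-letter c` at most four.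
growth : ℕ → ℕ
growth zero = 4
growth (suc n) = growth n * 2

growth-nonZero : ∀ n → NonZero (growth n)
growth-nonZero zero = _
growth-nonZero (suc n) = m*n≢0 (growth n) 2 {{growth-nonZero n}}

length-h₁₂-letter≤4 : ∀ c → length (h₁₂-letter c) ≤ 4
length-h₁₂-letter≤4 = from-yes (Fin.all? (λ c → length (h₁₂-letter c) ≤? 4))

length-h₁₂ : ∀ y → length (h₁₂ y) ≤ 4 * length y
length-h₁₂ = length-concatMap-≤ h₁₂-letter 4 length-h₁₂-letter≤4

length-H-≤ : ∀ n y → length (H n y) ≤ growth n * length y
length-H-≤ zero y = length-h₁₂ y
length-H-≤ (suc n) y = begin
  length (H n (σ* y))              ≤⟨ length-H-≤ n (σ* y) ⟩
  growth n * length (σ* y)         ≤⟨ *-monoʳ-≤ (growth n) (length-σ* y) ⟩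
  growth n * (2 * length y)        ≡⟨ *-assoc (growth n) 2 (length y) ⟨
  growth n * 2 * length y          ∎
  where open ≤-Reasoning

level : ℕ → ℕ
level zero = 2
level (suc m) = 3 + level m

-- σ³ maps every letter to at least two letters, while h₁₂ (σ c) may still be empty.
length-H-≥ : ∀ m c → m < length (H (level m) (c ∷ []))
length-H-≥ zero c = from-yes (Fin.all? (λ c → 0 <? length (H 2 (c ∷ [])))) c
length-H-≥ (suc m) c = go c
  where
  two-letters : ∀ a b v → suc m < length (H (level m) (a ∷ b ∷ v))
  two-letters a b v = begin
    suc (suc m)                                           ≤⟨ s≤s (m≤n+m (suc m) m) ⟩
    suc m + suc m                                         ≤⟨ +-mono-≤ (length-H-≥ m a) (length-H-≥ m b) ⟩
    length (H k (a ∷ [])) + length (H k (b ∷ []))         ≡⟨ length-++ (H k (a ∷ [])) ⟨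
    length (H k (a ∷ []) ++ H k (b ∷ []))                 ≡⟨ cong length (H-++ k (a ∷ []) (b ∷ [])) ⟨
    length (H k (a ∷ b ∷ []))                             ≤⟨ length-factor (H-factor k (prefix-++ (a ∷ b ∷ []))) ⟩
    length (H k (a ∷ b ∷ v))                              ∎
    where
    open ≤-Reasoning
    k = level m
  go : ∀ c → suc m < length (H (level (suc m)) (c ∷ []))
  go 0F = two-letters _ _ _
  go 1F = two-letters _ _ _
  go 2F = two-letters _ _ _
  go 3F = two-letters _ _ _
  go 4F = two-letters _ _ _

abstract
  -- The only link between the list `fours` and the word `b₅` itself.
  fours-in-b₅ : All (λ g → Any (λ i → take 4 (drop i (b₅-prefix 7)) ≡ g) (upTo 41)) fours
  fours-in-b₅ = from-yes (All.all?
    (λ g → Any.any? (λ i → ≡-dec Fin._≟_ (take 4 (drop i (b₅-prefix 7))) g) (upTo 41)) fours)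

legal⇒b₅-factor : ∀ {x} → Legal x → x IsFactorOf b₅-prefix 7
legal⇒b₅-factor l with All.lookupAny fours-in-b₅ l
... | occurs , t , eq with Any.satisfied occurs
...   | i , eq′ = factor-trans ([] , t , eq) (take i b , drop 4 (drop i b) , (begin
  take i b ++ g ++ drop 4 (drop i b)                      ≡⟨ cong (λ u → take i b ++ u ++ drop 4 (drop i b)) eq′ ⟨
  take i b ++ take 4 (drop i b) ++ drop 4 (drop i b)      ≡⟨ cong (take i b ++_) (take++drop≡id 4 (drop i b)) ⟩
  take i b ++ drop i b                                    ≡⟨ take++drop≡id i b ⟩
  b                                                       ∎))
  where
  open ≡-Reasoning
  b = b₅-prefix 7
  g = Any.lookup l

-- Once the images of letters are longer than x, an occurrence of x meets at most two of them.
straddle : ∀ n {x} c d y → (∀ c → length x ≤ length (H n (c ∷ []))) → x IsFactorOf H n (c ∷ d ∷ y) →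
           x IsFactorOf H n (d ∷ y) ⊎ x IsFactorOf H n (c ∷ d ∷ [])
straddle n {x} c d y long (u , v , eq) with length (H n (c ∷ [])) ≤? length u
... | yes Hc≤u =
  let u′ , _ , eq′ = ++-split (H n (c ∷ [])) u (trans (sym (H-++ n (c ∷ []) (d ∷ y))) (sym eq)) Hc≤u
  in inj₁ (u′ , v , sym eq′)
... | no Hc≰u =
  let v′ , eq′ , _ = ++-split (u ++ x) (H n (c ∷ d ∷ []))
                       (trans (++-assoc u x v) (trans eq (H-++ n (c ∷ d ∷ []) y))) short
  in inj₂ (u , v′ , sym (trans eq′ (++-assoc u x v′)))
  where
  open ≤-Reasoning
  short : length (u ++ x) ≤ length (H n (c ∷ d ∷ []))
  short = begin
    length (u ++ x)                                   ≡⟨ length-++ u ⟩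
    length u + length x                               ≤⟨ +-mono-≤ (<⇒≤ (≰⇒> Hc≰u)) (long d) ⟩
    length (H n (c ∷ [])) + length (H n (d ∷ []))     ≡⟨ length-++ (H n (c ∷ [])) ⟨
    length (H n (c ∷ []) ++ H n (d ∷ []))             ≡⟨ cong length (H-++ n (c ∷ []) (d ∷ [])) ⟨
    length (H n (c ∷ d ∷ []))                         ∎

-- Letters are dropped from the front until `straddle` places `x` in the image of two adjacent
-- letters, a pair short enough to be legal.
locate : ∀ n {x} y → (∀ c → length x ≤ length (H n (c ∷ []))) → LocallyLegal y →
         x IsFactorOf H n y → ∃ λ z → Legal z × x IsFactorOf H n z
locate n [] _ ll f = [] , ll ([] , [] , refl) z≤n , f
locate n (c ∷ []) _ ll f = c ∷ [] , ll ([] , [] , refl) (s≤s z≤n) , f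
locate n (c ∷ d ∷ y) long ll f =
  [ locate n (d ∷ y) long (λ g → ll (factor-trans g (suffix-++ (c ∷ []))))
  , (λ g → c ∷ d ∷ [] , ll (prefix-++ (c ∷ d ∷ [])) (s≤s (s≤s z≤n)) , g)
  ]′ (straddle n c d y long f)

-- Decoding h₁₂

-- Fixes where erased letters stand: a `2` comes right after `1` or `4`, a `4` right before `2` and
-- never after `1`. Pairs foreign to `b₅`, such as `00`, are left to the finite check.
follows : Σ₅ → Σ₅ → Bool
follows 4F 2F = true
follows 4F _ = false
follows 1F 4F = false
follows 1F _ = true
follows _ 2F = false
follows _ _ = true

Follows : Σ₅ → Σ₅ → Set
Follows c d = T (follows c d)

linked-++ˡ : ∀ u {v} → Linked Follows (u ++ v) → Linked Follows u
linked-++ˡ [] l = []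
linked-++ˡ (c ∷ []) l = [-]
linked-++ˡ (c ∷ d ∷ u) (r ∷ l) = r ∷ linked-++ˡ (d ∷ u) l

linked-++ʳ : ∀ u {v} → Linked Follows (u ++ v) → Linked Follows v
linked-++ʳ [] l = l
linked-++ʳ (c ∷ u) l = linked-++ʳ u (Linked.tail l)

linked-factor : ∀ {x y} → x IsFactorOf y → Linked Follows y → Linked Follows x
linked-factor {x} (u , v , refl) l = linked-++ˡ x (linked-++ʳ u l)

periods≤16 : List ℕ
periods≤16 = 0 ∷ replicate 15 1

-- The scan starts with all twelve squares, so there is no room for a new one and any other square
-- of period at most 16 makes it fail.
Clean : Word → Set
Clean [] = ⊤
Clean (c ∷ xs) = T (is-just (scan periods≤16 0 c xs xs squares))

clean? : Decidable Clean
clean? [] = yes tt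
clean? (c ∷ xs) = T? _

Decodable : List Σ₅ → Set
Decodable y = Linked Follows y × All Clean (tails (h₁₂ y))

decodable? : Decidable Decodable
decodable? y = Linked.linked? (λ c d → T? (follows c d)) y ×-dec All.all? clean? (tails (h₁₂ y))

abstract
  decodable-legal : Checked decodable? 7
  decodable-legal = from-yes (All.all? (λ z → legal? (take 4 (drop 1 z))) (words decodable? 8))

-- The letter 4 is erased by h₁₂; it is restored between 0, 2 or 3 and a following 2.
-- The 1 in front of y says that y does not start with 4.
Decoded : Word → Set
Decoded x = ∃ λ y → ∃ λ b → h₁₂ y ++ b ≡ x × length b ≤ 4 × Linked Follows (1F ∷ y)

-- Used for `k` equal to `0`, `2` or `3`. The tuple lists what the linking needs; `Follows 1F k`
-- keeps the invariant that the decoded word does not start with `4`.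
emit : ∀ k → (Follows 1F k × Follows k 0F × Follows k 1F × Follows k 3F × Follows k 4F) →
       ∀ {x} → Decoded x → Decoded (h₁₂-letter k ++ x)
emit k (f , _) ([] , b , refl , b≤ , l) =
  k ∷ [] , b , ++-assoc (h₁₂-letter k) [] b , b≤ , f ∷ [-]
emit k (f , f₀ , _) (0F ∷ y , b , refl , b≤ , _ ∷ l) =
  k ∷ 0F ∷ y , b , ++-assoc (h₁₂-letter k) _ b , b≤ , f ∷ f₀ ∷ l
emit k (f , _ , f₁ , _) (1F ∷ y , b , refl , b≤ , _ ∷ l) =
  k ∷ 1F ∷ y , b , ++-assoc (h₁₂-letter k) _ b , b≤ , f ∷ f₁ ∷ l
emit k (f , _ , _ , _ , f₄) (2F ∷ y , b , refl , b≤ , _ ∷ l) =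
  -- The inserted `4` has empty image, so the decoded word is unchanged.
  k ∷ 4F ∷ 2F ∷ y , b , ++-assoc (h₁₂-letter k) _ b , b≤ , f ∷ f₄ ∷ _ ∷ l
emit k (f , _ , _ , f₃ , _) (3F ∷ y , b , refl , b≤ , _ ∷ l) =
  k ∷ 3F ∷ y , b , ++-assoc (h₁₂-letter k) _ b , b≤ , f ∷ f₃ ∷ l
emit k _ (4F ∷ y , _ , _ , _ , () ∷ _)

emit₁ : ∀ {x} → Decoded x → Decoded (h₁₂-letter 1F ++ x)
emit₁ (y , b , refl , b≤ , l) = 1F ∷ y , b , refl , b≤ , _ ∷ l

abstract
  no-letter-square : ∀ c → ¬ Legal (c ∷ c ∷ [])
  no-letter-square = from-yes (Fin.all? λ c → ¬? (legal? (c ∷ c ∷ [])))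

  no-pair-square : ∀ c d → ¬ Legal (c ∷ d ∷ c ∷ d ∷ [])
  no-pair-square = from-yes (Fin.all? λ c → Fin.all? λ d → ¬? (legal? (c ∷ d ∷ c ∷ d ∷ [])))

  -- A square `cdecde` contains both of these factors of length 4.
  no-level-square : ∀ c d e → Legal (c ∷ d ∷ e ∷ c ∷ []) → ¬ Legal (d ∷ e ∷ c ∷ d ∷ [])
  no-level-square = from-yes (Fin.all? λ c → Fin.all? λ d → Fin.all? λ e →
    legal? (c ∷ d ∷ e ∷ c ∷ []) →-dec ¬? (legal? (d ∷ e ∷ c ∷ d ∷ [])))

  -- Nonempty images of letters all start with `0`. The bound 8 is attained at `3421`; twice it is
  -- the 16 of `long-squares`.
  legal-image : ∀ c d e f → Legal (c ∷ d ∷ e ∷ f ∷ []) →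
                8 ≤ length (h₁₂ (c ∷ d ∷ e ∷ f ∷ [])) × (𝟎 ∷ []) IsPrefixOf h₁₂ (c ∷ d ∷ e ∷ f ∷ [])
  legal-image = from-yes (Fin.all? λ c → Fin.all? λ d → Fin.all? λ e → Fin.all? λ f →
    legal? (c ∷ d ∷ e ∷ f ∷ []) →-dec
      (8 ≤? length (h₁₂ (c ∷ d ∷ e ∷ f ∷ [])) ×-dec prefix? _≟ᴮ_ (𝟎 ∷ []) (h₁₂ (c ∷ d ∷ e ∷ f ∷ []))))

  -- Only the square of length 32 is that long, and it starts with `1`.
  long-squares : All (λ s → 16 ≤ length s → ¬ (𝟎 ∷ []) IsPrefixOf s) squares
  long-squares = from-yes (All.all? (λ s → 16 ≤? length s →-dec ¬? (prefix? _≟ᴮ_ (𝟎 ∷ []) s)) squares)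

extend : ∀ {w x} → FactorBi w x → ∀ m →
         ∃ λ l → ∃ λ r → length l ≡ m × length r ≡ m × FactorBi w (l ++ x ++ r)
extend {w} {x} f zero = [] , [] , refl , refl , subst (FactorBi w) (sym (++-identityʳ x)) f
extend {w} {x} f (suc m) =
  let l , r , |l| , |r| , f₁ = extend f m
      c , f₂ = extendˡ f₁
      d , f₃ = extendʳ f₂
  in c ∷ l , r ++ d ∷ [] , cong suc |l| ,
     trans (length-++ r) (trans (+-comm (length r) 1) (cong suc |r|)) ,
     subst (λ t → FactorBi w (c ∷ t))
       (trans (++-assoc l (x ++ r) (d ∷ [])) (cong (l ++_) (++-assoc x r (d ∷ [])))) f₃

module _ {w : BiWord} (only : OnlyOverlap01010 w) (few : AtMostSquares 12 w) where

  no-cube : ∀ c {v} → ¬ FactorBi w (c ∷ c ∷ c ∷ v)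
  no-cube c f with proj₂ only _ (isOverlap c []) (factor-++ˡ (c ∷ c ∷ c ∷ []) f)
  ... | ()

  -- Without cubes of letters, a run of `0` and the run of `1` after it form one of the four blocks.
  -- A block is emitted only once the next `0` is seen, as its last run might go on; the unfinished
  -- block becomes `b`.
  decode : ∀ x → FactorBi w (𝟎 ∷ x) → Decoded (𝟎 ∷ x)
  decode [] f = [] , _ , refl , s≤s z≤n , [-]
  decode (false ∷ []) f = [] , _ , refl , s≤s (s≤s z≤n) , [-]
  decode (false ∷ false ∷ x) f = ⊥-elim (no-cube false f)
  decode (false ∷ true ∷ []) f = [] , _ , refl , s≤s (s≤s (s≤s z≤n)) , [-]
  decode (false ∷ true ∷ false ∷ x) f = emit 2F _ (decode x (factor-++ʳ (𝟎 ∷ 𝟎 ∷ 𝟏 ∷ []) f))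
  decode (false ∷ true ∷ true ∷ []) f = [] , _ , refl , s≤s (s≤s (s≤s (s≤s z≤n))) , [-]
  decode (false ∷ true ∷ true ∷ false ∷ x) f =
    emit 0F _ (decode x (factor-++ʳ (𝟎 ∷ 𝟎 ∷ 𝟏 ∷ 𝟏 ∷ []) f))
  decode (false ∷ true ∷ true ∷ true ∷ x) f = ⊥-elim (no-cube true (factor-++ʳ (𝟎 ∷ 𝟎 ∷ []) f))
  decode (true ∷ []) f = [] , _ , refl , s≤s (s≤s z≤n) , [-]
  decode (true ∷ false ∷ x) f = emit₁ (decode x (factor-++ʳ (𝟎 ∷ 𝟏 ∷ []) f))
  decode (true ∷ true ∷ []) f = [] , _ , refl , s≤s (s≤s (s≤s z≤n)) , [-]
  decode (true ∷ true ∷ false ∷ x) f = emit 3F _ (decode x (factor-++ʳ (𝟎 ∷ 𝟏 ∷ 𝟏 ∷ []) f))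
  decode (true ∷ true ∷ true ∷ x) f = ⊥-elim (no-cube true (factor-++ʳ (𝟎 ∷ []) f))

  decode-factor : ∀ x → FactorBi w x → ∃ λ a → ∃ λ y → ∃ λ b →
                  x ≡ a ++ h₁₂ y ++ b × length a ≤ 2 × length b ≤ 4 × Linked Follows y
  decode-factor x f =
    let a , x′ , eq , a≤ , y , b , eq′ , b≤ , l = skip x f
    in a , y , b , trans eq (cong (a ++_) (sym eq′)) , a≤ , b≤ , Linked.tail l
    where
    skip : ∀ x → FactorBi w x → ∃ λ a → ∃ λ x′ → x ≡ a ++ x′ × length a ≤ 2 × Decoded x′
    skip [] f = [] , [] , refl , z≤n , [] , [] , refl , z≤n , [-]
    skip (false ∷ x) f = [] , _ , refl , z≤n , decode x f
    skip (true ∷ []) f = _ , [] , refl , s≤s z≤n , [] , [] , refl , z≤n , [-]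
    skip (true ∷ false ∷ x) f = 𝟏 ∷ [] , _ , refl , s≤s z≤n , decode x (factor-++ʳ (𝟏 ∷ []) f)
    skip (true ∷ true ∷ []) f = _ , [] , refl , s≤s (s≤s z≤n) , [] , [] , refl , z≤n , [-]
    skip (true ∷ true ∷ false ∷ x) f =
      𝟏 ∷ 𝟏 ∷ [] , _ , refl , s≤s (s≤s z≤n) , decode x (factor-++ʳ (𝟏 ∷ 𝟏 ∷ []) f)
    skip (true ∷ true ∷ true ∷ x) f = ⊥-elim (no-cube true f)

  factor-clean : ∀ {x} → FactorBi w x → Clean x
  factor-clean {[]} f = tt
  factor-clean {c ∷ xs} f = sound⇒just (scan periods≤16 0 c xs xs squares)
    (scan-sound only few periods≤16 0 c xs f (squares-unique , squares-square , squares-occur only few))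
    where
    sound⇒just : ∀ m → Sound only few m → T (is-just m)
    sound⇒just (just _) _ = tt

  Preimage : List Σ₅ → Set
  Preimage y = Linked Follows y × FactorBi w (h₁₂ y)

  preimage-factor : ∀ {x y} → x IsFactorOf y → Preimage y → Preimage x
  preimage-factor x⊑y (l , f) =
    linked-factor x⊑y l , factor-infix (concatMap-factor h₁₂-letter x⊑y) f

  preimage⇒decodable : ∀ {y} → Preimage y → Decodable y
  preimage⇒decodable {y} (l , f) = l , All-tails (h₁₂ y) (λ s⊑ → factor-clean (factor-infix s⊑ f))

  preimage-locallyLegal : ∀ c y e → length e ≡ 7 → Preimage (c ∷ y ++ e) → LocallyLegal y
  preimage-locallyLegal = locally-legal {P = Preimage} {Q = Decodable} decodable? preimage⇒decodable
    preimage-factor 7 (m≤m+n 4 3) decodable-legal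

  -- Roots of at most three letters contradict legality. A longer root would give a square of `w` of
  -- length at least 16 starting with `0`.
  preimage-squareFree : ∀ y → LocallyLegal y → FactorBi w (h₁₂ y) → SquareFree y
  preimage-squareFree y ll f {[]} _ = refl
  preimage-squareFree y ll f {c ∷ []} sq = ⊥-elim (no-letter-square c (ll sq (s≤s (s≤s z≤n))))
  preimage-squareFree y ll f {c ∷ d ∷ []} sq = ⊥-elim (no-pair-square c d (ll sq ≤-refl))
  preimage-squareFree y ll f {c ∷ d ∷ e ∷ []} sq = ⊥-elim (no-level-square c d e
    (ll (factor-trans (infix-++ [] (d ∷ e ∷ [])) sq) ≤-refl)
    (ll (factor-trans (infix-++ (c ∷ []) (e ∷ [])) sq) ≤-refl))
  preimage-squareFree y ll f {x@(c ∷ d ∷ e ∷ g ∷ x′)} sq = ⊥-elim (All.lookup long-squares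
    (squares-exhaustive only few (t , nonempty , refl) (factor-infix (subst (_IsFactorOf h₁₂ y)
      (concatMap-++ h₁₂-letter x x) (concatMap-factor h₁₂-letter sq)) f))
    (≤-trans (+-mono-≤ long long) (≤-reflexive (sym (length-++ t))))
    (proj₁ starts ++ t , cong (_++ t) (proj₂ starts)))
    where
    t = h₁₂ x
    image = legal-image c d e g (ll (factor-trans (prefix-++ (c ∷ d ∷ e ∷ g ∷ [])) sq) ≤-refl)
    long : 8 ≤ length t
    long = ≤-trans (proj₁ image)
      (length-factor (concatMap-factor h₁₂-letter (prefix-++ (c ∷ d ∷ e ∷ g ∷ []) {x′})))
    starts : (𝟎 ∷ []) IsPrefixOf t
    starts = proj₁ (proj₂ image) ++ h₁₂ x′ ,
      trans (cong (_++ h₁₂ x′) (proj₂ (proj₂ image))) (sym (concatMap-++ h₁₂-letter (c ∷ d ∷ e ∷ g ∷ []) x′))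
    nonempty : t ≢ []
    nonempty eq with subst (λ u → 8 ≤ length u) eq long
    ... | ()

  -- Covering factors of `w` by images of nice words

  -- That `H n y` occurs in `w` serves the inclusion of `h₁₂ (b₅)` in `w`; that it contains `x`
  -- serves the other one.
  Covered : ℕ → Word → Set
  Covered n x = ∃ λ y → Nice y × FactorBi w (H n y) × x IsFactorOf H n y

  cover-zero : ∀ {x} → FactorBi w x → Covered 0 x
  cover-zero {x} f =
    -- The margin 40 exceeds `4 · 8 + 6 = 38`, which ensures eight decoded letters, and the losses
    -- `2 + 4` on the left and `4 · 7 + 4` on the right.
    let l , r , |l| , |r| , f′ = extend f 40
        a , y , b , eq , a≤ , b≤ , linked = decode-factor (l ++ x ++ r) f′
    in trim l r a y b |l| |r| f′ eq a≤ b≤ linked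
    where
    trim : ∀ l r a y b → length l ≡ 40 → length r ≡ 40 → FactorBi w (l ++ x ++ r) →
           l ++ x ++ r ≡ a ++ h₁₂ y ++ b → length a ≤ 2 → length b ≤ 4 → Linked Follows y → Covered 0 x
    trim l r a y b |l| |r| f′ eq a≤ b≤ linked with middle-split 7 y long-y
      where
      open ≤-Reasoning
      long-y : 8 ≤ length y
      long-y = *-cancelˡ-≤ 4 (+-cancelʳ-≤ 6 (4 * 8) (4 * length y) (begin
        38                                              ≤⟨ m≤m+n 38 2 ⟩
        40                                              ≡⟨ |l| ⟨
        length l                                        ≤⟨ length-factor (prefix-++ l) ⟩
        length (l ++ x ++ r)                            ≡⟨ cong length eq ⟩
        length (a ++ h₁₂ y ++ b)                        ≡⟨ trans (length-++ a) (cong (length a +_) (length-++ (h₁₂ y))) ⟩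
        length a + (length (h₁₂ y) + length b)          ≤⟨ +-mono-≤ a≤ (+-mono-≤ (length-h₁₂ y) b≤) ⟩
        2 + (4 * length y + 4)                          ≡⟨ trans (+-comm 2 _) (+-assoc (4 * length y) 4 2) ⟩
        4 * length y + 6                                ∎))
    ... | c , m , e , refl , |e| =
      m , (preimage-squareFree m legal fm , legal) , fm ,
      infix-trim l r (a ++ h₁₂-letter c) (h₁₂ m) (h₁₂ e ++ b) (trans eq regroup) left≤ right≤
      where
      f-image : FactorBi w (h₁₂ (c ∷ m ++ e))
      f-image = factor-infix (infix-++ a b) (subst (FactorBi w) eq f′)
      legal : LocallyLegal m
      legal = preimage-locallyLegal c m e |e| (linked , f-image)
      fm : FactorBi w (h₁₂ m)
      fm = factor-infix (concatMap-factor h₁₂-letter (infix-++ (c ∷ []) {m} e)) f-image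
      hc = h₁₂-letter c
      regroup : a ++ (hc ++ h₁₂ (m ++ e)) ++ b ≡ (a ++ hc) ++ h₁₂ m ++ h₁₂ e ++ b
      regroup = begin
        a ++ (hc ++ h₁₂ (m ++ e)) ++ b           ≡⟨ cong (λ t → a ++ (hc ++ t) ++ b) (concatMap-++ h₁₂-letter m e) ⟩
        a ++ (hc ++ h₁₂ m ++ h₁₂ e) ++ b         ≡⟨ cong (a ++_) (++-assoc hc (h₁₂ m ++ h₁₂ e) b) ⟩
        a ++ hc ++ (h₁₂ m ++ h₁₂ e) ++ b         ≡⟨ cong (λ t → a ++ hc ++ t) (++-assoc (h₁₂ m) (h₁₂ e) b) ⟩
        a ++ hc ++ h₁₂ m ++ h₁₂ e ++ b           ≡⟨ ++-assoc a hc _ ⟨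
        (a ++ hc) ++ h₁₂ m ++ h₁₂ e ++ b         ∎
        where open ≡-Reasoning
      open ≤-Reasoning
      left≤ : length (a ++ hc) ≤ length l
      left≤ = begin
        length (a ++ hc)              ≡⟨ length-++ a ⟩
        length a + length hc          ≤⟨ +-mono-≤ a≤ (length-h₁₂-letter≤4 c) ⟩
        6                             ≤⟨ m≤m+n 6 34 ⟩
        40                            ≡⟨ |l| ⟨
        length l                      ∎
      right≤ : length (h₁₂ e ++ b) ≤ length r
      right≤ = begin
        length (h₁₂ e ++ b)           ≡⟨ length-++ (h₁₂ e) ⟩
        length (h₁₂ e) + length b     ≤⟨ +-mono-≤ (length-h₁₂ e) b≤ ⟩
        4 * length e + 4              ≡⟨ cong (λ k → 4 * k + 4) |e| ⟩
        32                            ≤⟨ m≤m+n 32 8 ⟩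
        40                            ≡⟨ |r| ⟨
        length r                      ∎

  cover-suc : ∀ n → (∀ {x} → FactorBi w x → Covered n x) → ∀ {x} → FactorBi w x → Covered (suc n) x
  cover-suc n cover {x} f =
    -- This margin forces `y` to have 16 letters and covers the images of the 3 and 13 letters lost.
    let l , r , |l| , |r| , f′ = extend f (growth n * 16)
        y , nice , fy , u , v , eq = cover f′
    in trim l r u v y |l| |r| nice fy eq
    where
    trim : ∀ l r u v y → length l ≡ growth n * 16 → length r ≡ growth n * 16 → Nice y →
           FactorBi w (H n y) → u ++ (l ++ x ++ r) ++ v ≡ H n y → Covered (suc n) x
    trim l r u v y |l| |r| nice fy eq with nice-desubstitute y nice long-y
      where
      open ≤-Reasoning
      long-y : 16 ≤ length y
      long-y = *-cancelˡ-≤ (growth n) {{growth-nonZero n}} (begin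
        growth n * 16               ≡⟨ |l| ⟨
        length l                    ≤⟨ length-factor (prefix-++ l) ⟩
        length (l ++ x ++ r)        ≤⟨ length-factor (u , v , eq) ⟩
        length (H n y)              ≤⟨ length-H-≤ n y ⟩
        growth n * length y         ∎)
    ... | p , z , s , refl , p≤ , s≤ , nice-z =
      z , nice-z , factor-infix (H-factor n (infix-++ p s)) fy ,
      infix-trim (u ++ l) (r ++ v) (H n p) (H n (σ* z)) (H n s) regroup left≤ right≤
      where
      regroup : (u ++ l) ++ x ++ r ++ v ≡ H n p ++ H n (σ* z) ++ H n s
      regroup = begin
        (u ++ l) ++ x ++ r ++ v           ≡⟨ ++-assoc u l _ ⟩
        u ++ l ++ x ++ r ++ v             ≡⟨ cong (λ t → u ++ l ++ t) (++-assoc x r v) ⟨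
        u ++ l ++ (x ++ r) ++ v           ≡⟨ cong (u ++_) (++-assoc l (x ++ r) v) ⟨
        u ++ (l ++ x ++ r) ++ v           ≡⟨ eq ⟩
        H n (p ++ σ* z ++ s)              ≡⟨ H-++ n p (σ* z ++ s) ⟩
        H n p ++ H n (σ* z ++ s)          ≡⟨ cong (H n p ++_) (H-++ n (σ* z) s) ⟩
        H n p ++ H n (σ* z) ++ H n s      ∎
        where open ≡-Reasoning
      open ≤-Reasoning
      left≤ : length (H n p) ≤ length (u ++ l)
      left≤ = begin
        length (H n p)              ≤⟨ length-H-≤ n p ⟩
        growth n * length p         ≤⟨ *-monoʳ-≤ (growth n) (≤-trans p≤ (m≤m+n 3 13)) ⟩
        growth n * 16               ≡⟨ |l| ⟨
        length l                    ≤⟨ length-factor (suffix-++ u) ⟩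
        length (u ++ l)             ∎
      right≤ : length (H n s) ≤ length (r ++ v)
      right≤ = begin
        length (H n s)              ≤⟨ length-H-≤ n s ⟩
        growth n * length s         ≤⟨ *-monoʳ-≤ (growth n) (≤-trans s≤ (m≤m+n 13 3)) ⟩
        growth n * 16               ≡⟨ |r| ⟨
        length r                    ≤⟨ length-factor (prefix-++ r) ⟩
        length (r ++ v)             ∎

  cover : ∀ n {x} → FactorBi w x → Covered n x
  cover zero = cover-zero
  cover (suc n) = cover-suc n (cover n)

  -- The two inclusions

  -- At this level each letter has an image longer than `x`, so `locate` puts `x` inside the image
  -- of a legal word, which occurs in `σ⁷(0)`.
  factor⇒b₅ : ∀ {x} → FactorBi w x → Factorh₁₂b₅ x
  factor⇒b₅ {x} f =
    let n = level (length x)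
        y , (_ , ll) , _ , x⊑ = cover n f
        z , legal , x⊑z = locate n y (λ c → <⇒≤ (length-H-≥ (length x) c)) ll x⊑
    in n + 7 , subst (x IsFactorOf_) (H-b₅-prefix n 7)
                 (factor-trans x⊑z (H-factor n (legal⇒b₅-factor legal)))

  -- The one-letter factor only guarantees that the covering word is nonempty; three of the `3 + n`
  -- substitutions then turn its first letter into a word containing `0`.
  b₅-prefix-occurs : ∀ n {c₀} → Covered (3 + n) (c₀ ∷ []) → FactorBi w (h₁₂ (b₅-prefix n))
  b₅-prefix-occurs n {c₀} ([] , _ , _ , c₀⊑)
    with length-factor (subst ((c₀ ∷ []) IsFactorOf_) (H-[] n) c₀⊑)
  ... | ()
  b₅-prefix-occurs n (c ∷ y , _ , f , _) = subst (FactorBi w)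
    (trans (H-b₅-prefix n 0) (cong (λ k → h₁₂ (b₅-prefix k)) (+-identityʳ n)))
    (factor-infix (factor-trans (H-factor n (contains-0 c)) (H-factor (3 + n) (prefix-++ (c ∷ []) {y}))) f)
    where
    contains-0 : ∀ c → (0F ∷ []) IsFactorOf σ* (σ* (σ* (c ∷ [])))
    contains-0 0F = [] , _ , refl
    contains-0 1F = [] , _ , refl
    contains-0 2F = [] , _ , refl
    contains-0 3F = [] , _ , refl
    contains-0 4F = [] , _ , refl

  b₅⇒factor : ∀ {x} → Factorh₁₂b₅ x → FactorBi w x
  b₅⇒factor (n , x⊑) =
    factor-infix x⊑ (b₅-prefix-occurs n (cover (3 + n) {w (pos 0) ∷ []} (pos 0 , refl)))

theorem8 : (w : BiWord) → OnlyOverlap01010 w → AtMostSquares 12 w →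
    ∀ (x : Word) → FactorBi w x ⇔ Factorh₁₂b₅ x
theorem8 w only few x = mk⇔ (factor⇒b₅ only few) (b₅⇒factor only few)
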